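{- Let $G=(V,E,w)$ be a finite connected graph with $|V|=n\ge2$ and weights $w:E\to\mathbb{R}_{>0}$. Then $$\operatorname{OPT}_D^-(G,w)=\operatorname{OPT}_{\mathrm{card}}(G,w)=\min_{T\in\mathcal T_{\mathrm{conn}}^{\mathrm{bin}}(G)}\ \sum_{xy\in E}w_{xy}h_T(x,y).$$ Moreover, for every $T\in\mathcal T_{\mathrm{conn}}^{\mathrm{bin}}(G)$ and all distinct $x,y\in V$, $$d_G(x,y)\le\operatorname{diam}_{d_G}\bigl(C_T(x,y)\bigr)\le|C_T(x,y)|-1=h_T(x,y)$$ (for $x=y$ all terms are $0$). Thus $h_T\ge d_G$ on all pairs in $V\times V$, not only on the edges.
   Context: $d_G$ is the shortest-path metric of the support graph $(V,E)$ with every edge of length $1$; the weights are not edge lengths. $\operatorname{diam}_{d_G}(S)=\max_{a,b\in S}d_G(a,b)$. A rooted binary hierarchy $T$ on $V$ is a rooted tree whose leaves are the vertices of $V$ and whose internal nodes have exactly two children; each node is identified with the set of leaves in its subtree (a cluster), and $C_T(x,y)$ is the cluster of the lowest common ancestor of $x,y$ (so $C_T(x,x)=\{x\}$). $\mathcal T_{\mathrm{bin}}(V)$ is the set of all rooted binary hierarchies on $V$, and $\mathcal T_{\mathrm{conn}}^{\mathrm{bin}}(G)$ the subset of those all of whose clusters induce connected subgraphs of $G$. The shifted cardinality labeling is $h_T(x,x)=0$ and $h_T(x,y)=|C_T(x,y)|-1$ for $x\neq y$. $\operatorname{OPT}_D^-(G,w)=\min_{T\in\mathcal T_{\mathrm{bin}}(V)}\sum_{xy\in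 E}w_{xy}(|C_T(x,y)|-1)$ is the shifted Dasgupta optimum. $\operatorname{OPT}_{\mathrm{card}}(G,w)$ is the minimum of $\sum_{xy\in E}w_{xy}h_H(x,y)$ over all $H\in\mathcal T_{\mathrm{bin}}(V)$ with $h_H(x,y)\ge d_G(x,y)$ for all $x,y\in V$. -}

module Defs where

open import Level using (Level; _⊔_; 0ℓ)
open import Algebra.Bundles using (CommutativeRing)
open import Data.Bool.Base using (Bool; T; if_then_else_)
open import Data.Bool.Properties using (T?)
open import Data.Fin.Base as Fin using (Fin)
open import Data.Fin.Properties using (any?) renaming (_≟_ to _≟ᶠ_; _<?_ to _<ᶠ?_)
open import Data.Fin.Subset using (Subset; _∈_; _∪_; ⁅_⁆; ∣_∣)
open import Data.Fin.Subset.Properties using (_∈?_)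
open import Data.List.Base as List using (List; []; _∷_; [_]; _++_)
open import Data.List.Extrema.Nat using (max)
open import Data.List.Membership.Propositional using () renaming (_∈_ to _∈ˡ_)
open import Data.List.Relation.Unary.All using (All)
open import Data.List.Relation.Unary.Unique.Propositional using (Unique)
open import Data.Nat.Base as ℕ using (ℕ; zero; suc; z≤n; s≤s; _∸_)
open import Data.Product.Base using (∃; _×_; _,_; proj₁; proj₂; uncurry)
open import Data.Tree.Binary using (Tree; leaf; node; foldr)
open import Data.Unit.Base using (⊤)
open import Function.Base using (_on_)
open import Relation.Binary.Core using (Rel)
open import Relation.Binary.PropositionalEquality.Core using (refl)
open import Relation.Binary.Structures using (IsTotalOrder)
import Algebra.Definitions.RawMonoid as RawMonoid
import Relation.Binary.Construct.NonStrictToStrict as NonStrictToStrict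
open import Relation.Nullary using (¬_; Dec; yes; no; does; contradiction)
open import Relation.Nullary.Decidable using (_×-dec_; map′)

private
  variable
    a ℓ : Level
    n : ℕ

-- The library has no real numbers, so weights are taken in an arbitrary
-- linearly ordered field, of which ℝ (classically) is an instance.
record OrderedField (c ℓ₁ ℓ₂ : Level) : Set (Level.suc (c ⊔ ℓ₁ ⊔ ℓ₂)) where
  infix 4 _≤_
  field
    commutativeRing : CommutativeRing c ℓ₁
  open CommutativeRing commutativeRing public
  field
    _≤_          : Rel Carrier ℓ₂
    isTotalOrder : IsTotalOrder _≈_ _≤_
    +-monoʳ-≤    : ∀ x {y z} → y ≤ z → x + y ≤ x + z
    *-nonneg     : ∀ {x y} → 0# ≤ x → 0# ≤ y → 0# ≤ x * y
    0≉1          : ¬ 0# ≈ 1#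
    inverse      : ∀ x → ¬ x ≈ 0# → ∃ λ y → x * y ≈ 1#

  open NonStrictToStrict _≈_ _≤_ public using (_<_)
  open RawMonoid +-rawMonoid public using (sum) renaming (_×_ to _·_)

  fromℕ : ℕ → Carrier
  fromℕ k = k · 1#

data Walk {A : Set a} (R : Rel A ℓ) : ℕ → A → A → Set (a ⊔ ℓ) where
  []  : ∀ {x} → Walk R 0 x x
  _∷_ : ∀ {k x y z} → R x y → Walk R k y z → Walk R (suc k) x z

Connected : {A : Set a} → Rel A ℓ → Set (a ⊔ ℓ)
Connected R = ∀ x y → ∃ λ k → Walk R k x y

record Graph (n : ℕ) : Set where
  field
    adj    : Fin n → Fin n → Bool
    sym    : ∀ {x y} → T (adj x y) → T (adj y x)
    irrefl : ∀ {x} → ¬ T (adj x x)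

  Adj : Rel (Fin n) 0ℓ
  Adj x y = T (adj x y)

  -- An unordered pair of adjacent vertices, represented once by its
  -- increasing ordering.
  record Edge : Set where
    constructor edge
    field
      {src tgt} : Fin n
      src<tgt   : src Fin.< tgt
      adjacent  : Adj src tgt

  Induced : (S : Subset n) → Rel (∃ (_∈ S)) 0ℓ
  Induced S = Adj on proj₁

  walk? : ∀ k x y → Dec (Walk Adj k x y)
  walk? zero    x y = map′ (λ { refl → [] }) (λ { [] → refl }) (x ≟ᶠ y)
  walk? (suc k) x y =
    map′ (λ (_ , xz , zy) → xz ∷ zy) (λ { (xz ∷ zy) → _ , xz , zy })
         (any? λ z → T? (adj x z) ×-dec walk? k z y)

IsLeast : (ℕ → Set ℓ) → ℕ → Set ℓ
IsLeast P k = P k × (∀ m → P m → k ℕ.≤ m)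

least : {P : ℕ → Set ℓ} → (∀ k → Dec (P k)) → ∀ k → P k → ∃ (IsLeast P)
least P? zero p = zero , p , λ _ _ → z≤n
least {P = P} P? (suc k) p with P? zero
... | yes p₀ = zero , p₀ , λ _ _ → z≤n
... | no ¬p₀ with least (λ m → P? (suc m)) k p
...   | j , q , j≤ = suc j , q , suc-j≤
  where
  suc-j≤ : ∀ m → P m → suc j ℕ.≤ m
  suc-j≤ zero    r = contradiction r ¬p₀
  suc-j≤ (suc m) r = s≤s (j≤ m r)

elements : Subset n → List (Fin n)
elements S = List.filter (_∈? S) (List.allFin _)

module Metric (G : Graph n) (conn : Connected (Graph.Adj G)) where
  open Graph G

  shortest : ∀ x y → ∃ (IsLeast λ k → Walk Adj k x y)
  shortest x y = uncurry (least λ k → walk? k x y) (conn x y)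

  dist : Fin n → Fin n → ℕ
  dist x y = proj₁ (shortest x y)

  diam : Subset n → ℕ
  diam S = max 0 (List.map (uncurry dist)
                           (List.cartesianProduct (elements S) (elements S)))

BinTree : ℕ → Set
BinTree n = Tree ⊤ (Fin n)

leaves : BinTree n → List (Fin n)
leaves = foldr (λ l _ r → l ++ r) [_]

-- Set of leaves below the root.
cluster : BinTree n → Subset n
cluster = foldr (λ l _ r → l ∪ r) ⁅_⁆

clusters : BinTree n → List (Subset n)
clusters t@(leaf _)     = cluster t ∷ []
clusters t@(node l _ r) = cluster t ∷ clusters l ++ clusters r

-- Cluster of the lowest common ancestor: descend from the root for as long
-- as a single child contains both x and y.
lcaCluster : BinTree n → Fin n → Fin n → Subset n
lcaCluster t@(leaf _)     x y = cluster t
lcaCluster t@(node l _ r) x y =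
  if      does ((x ∈? cluster l) ×-dec (y ∈? cluster l)) then lcaCluster l x y
  else if does ((x ∈? cluster r) ×-dec (y ∈? cluster r)) then lcaCluster r x y
  else    cluster t

-- The children of a node are ordered here; nothing below depends on the order.
record Hierarchy (n : ℕ) : Set where
  field
    tree     : BinTree n
    unique   : Unique (leaves tree)
    complete : ∀ x → x ∈ˡ leaves tree

  C : Fin n → Fin n → Subset n
  C = lcaCluster tree

  h : Fin n → Fin n → ℕ
  h x y = if does (x ≟ᶠ y) then 0 else ∣ C x y ∣ ∸ 1

ConnectedClusters : Graph n → Hierarchy n → Set
ConnectedClusters G H =
  All (λ S → Connected (Graph.Induced G S)) (clusters (Hierarchy.tree H))

module Optima {c ℓ₁ ℓ₂} (K : OrderedField c ℓ₁ ℓ₂) (G : Graph n) where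
  open OrderedField K using (Carrier; _≈_; _≤_; _<_; _*_; 0#; sum; fromℕ)
  open Graph G

  Positive : (Edge → Carrier) → Set (ℓ₁ ⊔ ℓ₂)
  Positive w = ∀ e → 0# < w e

  module _ (w : Edge → Carrier) where

    edgeTerm : (Fin n → Fin n → ℕ) → Fin n → Fin n → Carrier
    edgeTerm f x y with (x <ᶠ? y) ×-dec T? (adj x y)
    ... | yes (x<y , xy) = w (edge x<y xy) * fromℕ (f x y)
    ... | no  _          = 0#

    edgeSum : (Fin n → Fin n → ℕ) → Carrier
    edgeSum f = sum λ x → sum λ y → edgeTerm f x y

    cost : Hierarchy n → Carrier
    cost H = edgeSum (Hierarchy.h H)

    shiftedDasguptaCost : Hierarchy n → Carrier
    shiftedDasguptaCost H = edgeSum λ x y → ∣ Hierarchy.C H x y ∣ ∸ 1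

  IsMinimum : (Hierarchy n → Set) → (Hierarchy n → Carrier) → Carrier →
              Set (ℓ₁ ⊔ ℓ₂)
  IsMinimum P f m = (∃ λ H → P H × f H ≈ m) × (∀ H → P H → m ≤ f H)

  IsOPTᴰ⁻ : (Edge → Carrier) → Carrier → Set (ℓ₁ ⊔ ℓ₂)
  IsOPTᴰ⁻ w = IsMinimum (λ _ → ⊤) (shiftedDasguptaCost w)

  IsOPTcard : Connected Adj → (Edge → Carrier) → Carrier → Set (ℓ₁ ⊔ ℓ₂)
  IsOPTcard conn w =
    IsMinimum (λ H → ∀ x y → dist x y ℕ.≤ Hierarchy.h H x y) (cost w)
    where open Metric G conn

  IsOPTconn : (Edge → Carrier) → Carrier → Set (ℓ₁ ⊔ ℓ₂)
  IsOPTconn w = IsMinimum (ConnectedClusters G) (cost w)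

{-# OPTIONS --safe #-}
module Submission where

-- Every hierarchy T can be replaced by one with connected clusters that does not
-- enlarge the cluster C_T(x,y) of any edge xy. Bottom-up, each subtree of T is
-- turned into a forest of connected trees with no edges between them: at a node,
-- the forests of the two children are put together and trees touching each other
-- are joined. An edge inside a child keeps the (smaller) cluster it already had;
-- an edge across the node gets some cluster inside the node's own. At the root,
-- connectedness of G leaves a single tree. In a connected cluster S a loop-free
-- walk has at most |S| - 1 steps, so the new hierarchy is admissible for OPT_card.

open import Defs
open import Level using (Level)
open import Data.Bool.Properties using (T?)
open import Data.Fin.Base as Fin using (Fin)
open import Data.Fin.Properties as Fin using (any?; all?)
open import Data.Fin.Subset using (Subset; _∈_; _⊆_; _∪_; ⁅_⁆; ∣_∣; ⊤)
open import Data.Fin.Subset.Properties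
  using (_∈?_; x∈p∧x≢y⇒x∈p-y; x∈p⇒∣p-x∣<∣p∣; x∈p∪q⁺; x∈p∪q⁻; x∈⁅x⁆; x∈⁅y⁆⇒x≡y;
         ∈⊤; ∣p∣≤n; ∣⁅x⁆∣≡1; p⊆q⇒∣p∣≤∣q∣)
open import Data.List.Base as List
  using (List; []; _∷_; [_]; _++_; length; map; filter; concatMap; allFin; tabulate;
         cartesianProduct; cartesianProductWith)
open import Data.List.Extrema.Nat using (xs≤max; max≤v⁺)
import Data.List.Extrema as Extrema
import Data.List.Membership.DecPropositional as DecMembership
import Data.List.Relation.Unary.Unique.DecPropositional as DecUnique
open import Data.List.Properties using (++-assoc; ++-identityʳ; length-++)
open import Data.List.Membership.Propositional using (find; lose) renaming (_∈_ to _∈ˡ_)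
open import Data.List.Membership.Propositional.Properties
  using (∈-map⁺; ∈-++⁺ˡ; ∈-++⁺ʳ; ∈-++⁻; ∈-filter⁺; ∈-filter⁻; ∈-allFin; ∈-length;
         ∈-concatMap⁺; ∈-concatMap⁻; ∈-cartesianProduct⁺; ∈-cartesianProduct⁻;
         ∈-cartesianProductWith⁺)
open import Data.List.Relation.Binary.Disjoint.Propositional using (Disjoint)
open import Data.List.Relation.Binary.Permutation.Propositional
  using (_↭_; ↭-refl; ↭-sym; ↭-trans; ↭-reflexive; ↭⇒↭ₛ)
open import Data.List.Relation.Binary.Permutation.Propositional.Properties
  using (++⁺; ++⁺ˡ; ++⁺ʳ; ++-comm; shifts; ∈-resp-↭)
open import Data.List.Relation.Binary.Permutation.Setoid.Properties using (Unique-resp-↭)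
open import Data.List.Relation.Unary.All as All using (All; []; _∷_)
import Data.List.Relation.Unary.All.Properties as All
open import Data.List.Relation.Unary.AllPairs using (AllPairs; []; _∷_)
import Data.List.Relation.Unary.AllPairs.Properties as AllPairs
open import Data.List.Relation.Unary.Any using (here; there)
open import Data.List.Relation.Unary.Unique.Propositional using (Unique)
import Data.List.Relation.Unary.Unique.Propositional.Properties as Unique
open import Data.Nat.Base as ℕ using (ℕ; zero; suc; _≤_; _<_; _∸_; z≤n; s≤s; s≤s⁻¹)
open import Data.Nat.Properties
  using (≤-trans; ≤-reflexive; n≤0⇒n≡0; ∸-monoˡ-≤; m<m+n; m<n+m)
open import Data.Product.Base as Product using (∃; _×_; _,_; proj₁; proj₂; uncurry)
open import Data.Sum.Base as Sum using (_⊎_; inj₁; inj₂)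
open import Data.Tree.Binary using (leaf; node)
open import Data.Unit.Base using (tt)
open import Data.Vec.Properties.WithK using ([]=-irrelevant)
open import Function.Base using (_∘_)
open import Relation.Binary.Bundles using (TotalOrder)
open import Relation.Binary.Core using (Rel)
open import Relation.Binary.Definitions using (Symmetric)
open import Relation.Binary.PropositionalEquality
  using (_≡_; _≢_; refl; sym; trans; cong; subst; subst₂; setoid; ≢-sym)
open import Relation.Binary.Structures using (IsTotalOrder)
open import Relation.Nullary using (¬_; Dec; yes; no; contradiction)
open import Relation.Nullary.Decidable using (_×-dec_; dec-true; dec-false)
open import Relation.Unary.Properties using (∁?)

private
  variable
    a ℓ : Level
    A B : Set a
    n : ℕ

open module Dec∈ {n} = DecMembership (Fin._≟_ {n}) using () renaming (_∈?_ to _∈ˡ?_)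
open module DecU {n} = DecUnique (Fin._≟_ {n}) using (unique?)

pairwise : {R : Rel A ℓ} → Symmetric R → ∀ {xs} → AllPairs R xs →
           ∀ {x y} → x ∈ˡ xs → y ∈ˡ xs → x ≡ y ⊎ R x y
pairwise R-sym (_  ∷ _) (here refl) (here refl) = inj₁ refl
pairwise R-sym (px ∷ _) (here refl) (there q)   = inj₂ (All.lookup px q)
pairwise R-sym (px ∷ _) (there p)   (here refl) = inj₂ (R-sym (All.lookup px p))
pairwise R-sym (_ ∷ ps) (there p)   (there q)   = pairwise R-sym ps p q

unique-++⁻ : (xs : List A) {ys : List A} → Unique (xs ++ ys) →
             Unique xs × Unique ys × Disjoint xs ys
unique-++⁻ []       u        = [] , u , λ { (() , _) }
unique-++⁻ (x ∷ xs) (px ∷ u) with unique-++⁻ xs u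
... | uˡ , uʳ , disj = All.++⁻ˡ xs px ∷ uˡ , uʳ , λ
  { (here refl , q) → All.lookup (All.++⁻ʳ xs px) q refl
  ; (there p   , q) → disj (p , q) }

unique-concatMap⁻ : {f : A → List B} {xs : List A} → Unique (concatMap f xs) →
                    ∀ {x} → x ∈ˡ xs → Unique (f x)
unique-concatMap⁻ {f = f} {x ∷ _} u (here refl) = proj₁ (unique-++⁻ (f x) u)
unique-concatMap⁻ {f = f} {x ∷ _} u (there p)   =
  unique-concatMap⁻ (proj₁ (proj₂ (unique-++⁻ (f x) u))) p

concatMap-filter-↭ : {P : A → Set ℓ} (P? : ∀ x → Dec (P x)) (f : A → List B) →
  ∀ xs → concatMap f (filter P? xs) ++ concatMap f (filter (∁? P?) xs) ↭
         concatMap f xs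
concatMap-filter-↭ P? f []       = ↭-refl
concatMap-filter-↭ P? f (x ∷ xs) with P? x
... | yes _ = ↭-trans (↭-reflexive (++-assoc (f x) _ _))
                      (++⁺ˡ (f x) (concatMap-filter-↭ P? f xs))
... | no  _ = ↭-trans (shifts (concatMap f (filter P? xs)) (f x))
                      (++⁺ˡ (f x) (concatMap-filter-↭ P? f xs))

unique⇒length≤∣p∣ : {xs : List (Fin n)} {p : Subset n} →
                    Unique xs → All (_∈ p) xs → length xs ≤ ∣ p ∣
unique⇒length≤∣p∣ []       []       = z≤n
unique⇒length≤∣p∣ (x≢ ∷ u) (x∈ ∷ q) = ≤-trans
  (s≤s (unique⇒length≤∣p∣ u
    (All.zipWith (λ (y∈ , x≢y) → x∈p∧x≢y⇒x∈p-y y∈ (≢-sym x≢y)) (q , x≢))))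
  (x∈p⇒∣p-x∣<∣p∣ x∈)

module _ {R : Rel A ℓ} where

  infixr 5 _++ʷ_

  _++ʷ_ : ∀ {j k x y z} → Walk R j x y → Walk R k y z → Walk R (j ℕ.+ k) x z
  []      ++ʷ w = w
  (r ∷ v) ++ʷ w = r ∷ (v ++ʷ w)

  visited : ∀ {k x y} → Walk R k x y → List A
  visited {x = x} []      = [ x ]
  visited {x = x} (_ ∷ w) = x ∷ visited w

  length-visited : ∀ {k x y} (w : Walk R k x y) → length (visited w) ≡ suc k
  length-visited []      = refl
  length-visited (_ ∷ w) = cong suc (length-visited w)

  Simple : (A → Set) → A → A → Set _
  Simple P x y = ∃ λ k → ∃ λ (w : Walk R k x y) →
                 Unique (visited w) × All P (visited w)

  simple-from : ∀ {P k x y z} (w : Walk R k x y) → Unique (visited w) →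
                All P (visited w) → z ∈ˡ visited w → Simple P z y
  simple-from []      u       p       (here refl) = _ , [] , u , p
  simple-from (r ∷ w) u       p       (here refl) = _ , r ∷ w , u , p
  simple-from (_ ∷ w) (_ ∷ u) (_ ∷ p) (there z∈)  = simple-from w u p z∈

module _ {G : Graph n} where
  open Graph G renaming (sym to adj-sym)

  loop-erase : ∀ {S k} {x y : ∃ (_∈ S)} → Walk (Induced S) k x y →
               Simple {R = Adj} (_∈ S) (proj₁ x) (proj₁ y)
  loop-erase {x = _ , x∈} [] = 0 , [] , [] ∷ [] , x∈ ∷ []
  loop-erase {x = x , x∈} (r ∷ w) with loop-erase w
  ... | k , v , u , p with x ∈ˡ? visited v
  ...   | yes x∈v = simple-from v u p x∈v
  ...   | no  x∉v = suc k , r ∷ v ,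
                    All.tabulate (λ { q refl → x∉v q }) ∷ u , x∈ ∷ p

  induced-mono : ∀ {A B k} {x y : ∃ (_∈ A)} (A⊆B : ∀ {z} → z ∈ A → z ∈ B) →
                 Walk (Induced A) k x y →
                 Walk (Induced B) k (Product.map₂ A⊆B x) (Product.map₂ A⊆B y)
  induced-mono A⊆B []      = []
  induced-mono A⊆B (r ∷ w) = r ∷ induced-mono A⊆B w

  connected-∪ : ∀ {A B a b} → Connected (Induced A) → Connected (Induced B) →
                a ∈ A → b ∈ B → Adj a b → Connected (Induced (A ∪ B))
  connected-∪ {A} {B} conA conB a∈A b∈B ab (x , x∈) (y , y∈) =
    walk (x∈p∪q⁻ A B x∈) (x∈p∪q⁻ A B y∈)
    where
    within : ∀ {S} → Connected (Induced S) → (S⊆ : ∀ {z} → z ∈ S → z ∈ A ∪ B) →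
             ∀ {x y} → x ∈ S → y ∈ S → ∀ {x∈ y∈} →
             ∃ λ k → Walk (Induced (A ∪ B)) k (x , x∈) (y , y∈)
    within con S⊆ x∈S y∈S {x∈} {y∈} =
      subst₂ (λ p q → ∃ λ k → Walk _ k (_ , p) (_ , q))
             ([]=-irrelevant _ x∈) ([]=-irrelevant _ y∈)
             (Product.map₂ (induced-mono S⊆) (con (_ , x∈S) (_ , y∈S)))

    inA : ∀ {z} → z ∈ A → z ∈ A ∪ B
    inA p = x∈p∪q⁺ (inj₁ p)

    inB : ∀ {z} → z ∈ B → z ∈ A ∪ B
    inB p = x∈p∪q⁺ (inj₂ p)

    walk : x ∈ A ⊎ x ∈ B → y ∈ A ⊎ y ∈ B →
           ∃ λ k → Walk (Induced (A ∪ B)) k (x , x∈) (y , y∈)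
    walk (inj₁ p) (inj₁ q) = within conA inA p q
    walk (inj₂ p) (inj₂ q) = within conB inB p q
    walk (inj₁ p) (inj₂ q) =
      _ , proj₂ (within conA inA p a∈A {y∈ = inA a∈A}) ++ʷ
          ab ∷ proj₂ (within conB inB b∈B q {x∈ = inB b∈B})
    walk (inj₂ p) (inj₁ q) =
      _ , proj₂ (within conB inB p b∈B {y∈ = inB b∈B}) ++ʷ
          adj-sym ab ∷ proj₂ (within conA inA a∈A q {x∈ = inA a∈A})

  connected-⁅⁆ : ∀ x → Connected (Induced ⁅ x ⁆)
  connected-⁅⁆ x (y , y∈) (z , z∈) with x∈⁅y⁆⇒x≡y x y∈ | x∈⁅y⁆⇒x≡y x z∈
  ... | refl | refl rewrite []=-irrelevant y∈ z∈ = 0 , []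

module _ (G : Graph n) (conn : Connected (Graph.Adj G)) where
  open Graph G hiding (sym)
  open Metric G conn

  dist-refl : ∀ x → dist x x ≡ 0
  dist-refl x = n≤0⇒n≡0 (proj₂ (proj₂ (shortest x x)) 0 [])

  dist≤diam : ∀ {S x y} → x ∈ S → y ∈ S → dist x y ≤ diam S
  dist≤diam x∈ y∈ = All.lookup (xs≤max 0 _)
    (∈-map⁺ (uncurry dist) (∈-cartesianProduct⁺ (∈-elements x∈) (∈-elements y∈)))
    where
    ∈-elements : ∀ {S x} → x ∈ S → x ∈ˡ elements S
    ∈-elements {S} {x} = ∈-filter⁺ (_∈? S) (∈-allFin x)

  diam≤∣S∣∸1 : ∀ S → Connected (Induced S) → diam S ≤ ∣ S ∣ ∸ 1
  diam≤∣S∣∸1 S con = max≤v⁺ z≤n (All.map⁺ (All.tabulate bound))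
    where
    dist≤ : ∀ {x y} → x ∈ S → y ∈ S → dist x y ≤ ∣ S ∣ ∸ 1
    dist≤ {x} {y} x∈ y∈ with loop-erase {G = G} (proj₂ (con (x , x∈) (y , y∈)))
    ... | k , w , u , p = ≤-trans (proj₂ (proj₂ (shortest x y)) k w)
      (∸-monoˡ-≤ 1 (≤-trans (≤-reflexive (sym (length-visited w)))
                            (unique⇒length≤∣p∣ u p)))

    bound : ∀ {xy} → xy ∈ˡ cartesianProduct (elements S) (elements S) →
            uncurry dist xy ≤ ∣ S ∣ ∸ 1
    bound xy∈ with ∈-cartesianProduct⁻ (elements S) (elements S) xy∈
    ... | x∈ , y∈ = dist≤ (proj₂ (∈-filter⁻ (_∈? S) {xs = allFin n} x∈))
                          (proj₂ (∈-filter⁻ (_∈? S) {xs = allFin n} y∈))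

  diam-⁅⁆ : ∀ x → diam ⁅ x ⁆ ≡ 0
  diam-⁅⁆ x = n≤0⇒n≡0 (≤-trans (diam≤∣S∣∸1 ⁅ x ⁆ (connected-⁅⁆ {G = G} x))
                               (≤-reflexive (cong (_∸ 1) (∣⁅x⁆∣≡1 x))))

∈-leaves⇒∈-cluster : (t : BinTree n) → ∀ {x} → x ∈ˡ leaves t → x ∈ cluster t
∈-leaves⇒∈-cluster (leaf z)     (here refl) = x∈⁅x⁆ z
∈-leaves⇒∈-cluster (node l _ r) p = x∈p∪q⁺
  (Sum.map (∈-leaves⇒∈-cluster l) (∈-leaves⇒∈-cluster r) (∈-++⁻ (leaves l) p))

∈-cluster⇒∈-leaves : (t : BinTree n) → ∀ {x} → x ∈ cluster t → x ∈ˡ leaves t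
∈-cluster⇒∈-leaves (leaf z)     p = here (x∈⁅y⁆⇒x≡y z p)
∈-cluster⇒∈-leaves (node l _ r) p with x∈p∪q⁻ (cluster l) (cluster r) p
... | inj₁ q = ∈-++⁺ˡ (∈-cluster⇒∈-leaves l q)
... | inj₂ q = ∈-++⁺ʳ (leaves l) (∈-cluster⇒∈-leaves r q)

some-leaf : (t : BinTree n) → ∃ (_∈ˡ leaves t)
some-leaf (leaf z)     = z , here refl
some-leaf (node l _ r) = Product.map₂ ∈-++⁺ˡ (some-leaf l)

cluster∈clusters : (t : BinTree n) → cluster t ∈ˡ clusters t
cluster∈clusters (leaf _)     = here refl
cluster∈clusters (node _ _ _) = here refl

-- A relational form of lcaCluster t x y ≡ S (for x ≢ y). Unlike lcaCluster, it is
-- preserved by grafting t into a larger tree even if leaves are not unique.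
data Joined {n} (x y : Fin n) : BinTree n → Subset n → Set where
  across  : ∀ {l r} → x ∈ˡ leaves l → y ∈ˡ leaves r →
            Joined x y (node l tt r) (cluster l ∪ cluster r)
  across′ : ∀ {l r} → y ∈ˡ leaves l → x ∈ˡ leaves r →
            Joined x y (node l tt r) (cluster l ∪ cluster r)
  left    : ∀ {l r S} → Joined x y l S → Joined x y (node l tt r) S
  right   : ∀ {l r S} → Joined x y r S → Joined x y (node l tt r) S

module _ {x y : Fin n} where

  joined : x ≢ y → (t : BinTree n) → x ∈ˡ leaves t → y ∈ˡ leaves t →
           ∃ (Joined x y t)
  joined x≢y (leaf z) (here refl) (here refl) = contradiction refl x≢y
  joined x≢y (node l _ r) x∈ y∈ with ∈-++⁻ (leaves l) x∈ | ∈-++⁻ (leaves l) y∈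
  ... | inj₁ p | inj₁ q = Product.map₂ left (joined x≢y l p q)
  ... | inj₁ p | inj₂ q = _ , across p q
  ... | inj₂ p | inj₁ q = _ , across′ q p
  ... | inj₂ p | inj₂ q = Product.map₂ right (joined x≢y r p q)

  joined⇒∈-leaves : ∀ {t S} → Joined x y t S → x ∈ˡ leaves t × y ∈ˡ leaves t
  joined⇒∈-leaves (across {l} p q)  = ∈-++⁺ˡ p , ∈-++⁺ʳ (leaves l) q
  joined⇒∈-leaves (across′ {l} q p) = ∈-++⁺ʳ (leaves l) p , ∈-++⁺ˡ q
  joined⇒∈-leaves (left j)          =
    Product.map ∈-++⁺ˡ ∈-++⁺ˡ (joined⇒∈-leaves j)
  joined⇒∈-leaves (right {l} j)     =
    Product.map (∈-++⁺ʳ (leaves l)) (∈-++⁺ʳ (leaves l)) (joined⇒∈-leaves j)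

  joined⇒⊆ : ∀ {t S} → Joined x y t S → S ⊆ cluster t
  joined⇒⊆ (across _ _)  p = p
  joined⇒⊆ (across′ _ _) p = p
  joined⇒⊆ (left j)      p = x∈p∪q⁺ (inj₁ (joined⇒⊆ j p))
  joined⇒⊆ (right j)     p = x∈p∪q⁺ (inj₂ (joined⇒⊆ j p))

  joined⇒∈ : ∀ {t S} → Joined x y t S → x ∈ S × y ∈ S
  joined⇒∈ (across {l} {r} p q)  = x∈p∪q⁺ (inj₁ (∈-leaves⇒∈-cluster l p)) ,
                                   x∈p∪q⁺ (inj₂ (∈-leaves⇒∈-cluster r q))
  joined⇒∈ (across′ {l} {r} q p) = x∈p∪q⁺ (inj₂ (∈-leaves⇒∈-cluster r p)) ,
                                   x∈p∪q⁺ (inj₁ (∈-leaves⇒∈-cluster l q))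
  joined⇒∈ (left j)              = joined⇒∈ j
  joined⇒∈ (right j)             = joined⇒∈ j

  joined⇒∈-clusters : ∀ {t S} → Joined x y t S → S ∈ˡ clusters t
  joined⇒∈-clusters (across _ _)  = here refl
  joined⇒∈-clusters (across′ _ _) = here refl
  joined⇒∈-clusters (left j)      = there (∈-++⁺ˡ (joined⇒∈-clusters j))
  joined⇒∈-clusters (right {l} j) =
    there (∈-++⁺ʳ (clusters l) (joined⇒∈-clusters j))

  lca-left : ∀ l r → x ∈ˡ leaves l → y ∈ˡ leaves l →
             lcaCluster (node l tt r) x y ≡ lcaCluster l x y
  lca-left l r p q
    rewrite dec-true ((x ∈? cluster l) ×-dec (y ∈? cluster l))
                     (∈-leaves⇒∈-cluster l p , ∈-leaves⇒∈-cluster l q) = refl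

  lca-right : ∀ l r → ¬ (x ∈ˡ leaves l × y ∈ˡ leaves l) →
              x ∈ˡ leaves r → y ∈ˡ leaves r →
              lcaCluster (node l tt r) x y ≡ lcaCluster r x y
  lca-right l r ¬l p q
    rewrite dec-false ((x ∈? cluster l) ×-dec (y ∈? cluster l))
                      (¬l ∘ Product.map (∈-cluster⇒∈-leaves l) (∈-cluster⇒∈-leaves l))
          | dec-true ((x ∈? cluster r) ×-dec (y ∈? cluster r))
                     (∈-leaves⇒∈-cluster r p , ∈-leaves⇒∈-cluster r q) = refl

  lca-across : ∀ l r → ¬ (x ∈ˡ leaves l × y ∈ˡ leaves l) →
               ¬ (x ∈ˡ leaves r × y ∈ˡ leaves r) →
               lcaCluster (node l tt r) x y ≡ cluster l ∪ cluster r
  lca-across l r ¬l ¬r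
    rewrite dec-false ((x ∈? cluster l) ×-dec (y ∈? cluster l))
                      (¬l ∘ Product.map (∈-cluster⇒∈-leaves l) (∈-cluster⇒∈-leaves l))
          | dec-false ((x ∈? cluster r) ×-dec (y ∈? cluster r))
                      (¬r ∘ Product.map (∈-cluster⇒∈-leaves r) (∈-cluster⇒∈-leaves r))
          = refl

  lcaCluster-joined : ∀ {t S} → Unique (leaves t) → Joined x y t S →
                      lcaCluster t x y ≡ S
  lcaCluster-joined u (across {l} {r} p q) with unique-++⁻ (leaves l) u
  ... | _ , _ , disj = lca-across l r (λ (_ , q′) → disj (q′ , q))
                                  (λ (p′ , _) → disj (p , p′))
  lcaCluster-joined u (across′ {l} {r} q p) with unique-++⁻ (leaves l) u
  ... | _ , _ , disj = lca-across l r (λ (p′ , _) → disj (p′ , p))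
                                  (λ (_ , q′) → disj (q , q′))
  lcaCluster-joined u (left {l} {r} j) with unique-++⁻ (leaves l) u
  ... | uˡ , _ , _ = trans (uncurry (lca-left l r) (joined⇒∈-leaves j))
                           (lcaCluster-joined uˡ j)
  lcaCluster-joined u (right {l} {r} j) with unique-++⁻ (leaves l) u
  ... | _ , uʳ , disj with joined⇒∈-leaves j
  ...   | p , q = trans (lca-right l r (λ (p′ , _) → disj (p′ , p)) p q)
                        (lcaCluster-joined uʳ j)

lcaCluster-self : (t : BinTree n) → Unique (leaves t) → ∀ {x} → x ∈ˡ leaves t →
                  lcaCluster t x x ≡ ⁅ x ⁆
lcaCluster-self (leaf _)     u (here refl) = refl
lcaCluster-self (node l _ r) u x∈ with unique-++⁻ (leaves l) u | ∈-++⁻ (leaves l) x∈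
... | uˡ , _  , _    | inj₁ p = trans (lca-left l r p p) (lcaCluster-self l uˡ p)
... | _  , uʳ , disj | inj₂ p =
  trans (lca-right l r (λ (p′ , _) → disj (p′ , p)) p p) (lcaCluster-self r uʳ p)

module Coarsening (G : Graph n) where
  open Graph G renaming (sym to adj-sym)

  Touch Apart : Rel (BinTree n) _
  Touch t u = ∃ λ x → ∃ λ y → x ∈ˡ leaves t × y ∈ˡ leaves u × Adj x y
  Apart t u = ¬ Touch t u

  touch? : ∀ t u → Dec (Touch t u)
  touch? t u = any? λ x → any? λ y →
    (x ∈ˡ? leaves t) ×-dec (y ∈ˡ? leaves u) ×-dec T? (adj x y)

  apart-sym : Symmetric Apart
  apart-sym ¬tu (x , y , x∈ , y∈ , xy) = ¬tu (y , x , y∈ , x∈ , adj-sym xy)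

  same-or-apart : ∀ {F u v} → AllPairs Apart F → u ∈ˡ F → v ∈ˡ F →
                  u ≡ v ⊎ Apart u v
  same-or-apart ap = pairwise (λ {t} {u} → apart-sym {t} {u}) ap

  ConnectedTree : BinTree n → Set
  ConnectedTree t = All (λ S → Connected (Induced S)) (clusters t)

  connected-node : ∀ {s u} → ConnectedTree s → ConnectedTree u → Touch s u →
                   ConnectedTree (node s tt u)
  connected-node {s} {u} cs cu (x , y , x∈ , y∈ , xy) =
    connected-∪ {G = G} (All.lookup cs (cluster∈clusters s))
                (All.lookup cu (cluster∈clusters u))
                (∈-leaves⇒∈-cluster s x∈) (∈-leaves⇒∈-cluster u y∈) xy
    ∷ All.++⁺ cs cu

  attach : BinTree n → List (BinTree n) → BinTree n
  attach t = List.foldr (λ u s → node s tt u) t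

  absorb : BinTree n → List (BinTree n) → List (BinTree n)
  absorb t F = attach t (filter (touch? t) F) ∷ filter (∁? (touch? t)) F

  merge : List (BinTree n) → List (BinTree n) → List (BinTree n)
  merge F F′ = List.foldr absorb F′ F

  coarsen : BinTree n → List (BinTree n)
  coarsen (leaf x)     = [ leaf x ]
  coarsen (node l _ r) = merge (coarsen l) (coarsen r)

  attach-↭ : ∀ t us → leaves (attach t us) ↭ leaves t ++ concatMap leaves us
  attach-↭ t []       = ↭-reflexive (sym (++-identityʳ (leaves t)))
  attach-↭ t (u ∷ us) = ↭-trans (++⁺ʳ (leaves u) (attach-↭ t us))
    (↭-trans (↭-reflexive (++-assoc (leaves t) _ _))
             (++⁺ˡ (leaves t) (++-comm (concatMap leaves us) (leaves u))))

  absorb-↭ : ∀ t F → concatMap leaves (absorb t F) ↭ leaves t ++ concatMap leaves F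
  absorb-↭ t F = ↭-trans
    (++⁺ʳ (concatMap leaves (filter (∁? (touch? t)) F)) (attach-↭ t (filter (touch? t) F)))
    (↭-trans (↭-reflexive (++-assoc (leaves t) _ _))
             (++⁺ˡ (leaves t) (concatMap-filter-↭ (touch? t) leaves F)))

  merge-↭ : ∀ F F′ → concatMap leaves (merge F F′) ↭
                     concatMap leaves F ++ concatMap leaves F′
  merge-↭ []      F′ = ↭-refl
  merge-↭ (t ∷ F) F′ = ↭-trans (absorb-↭ t (merge F F′))
    (↭-trans (++⁺ˡ (leaves t) (merge-↭ F F′))
             (↭-reflexive (sym (++-assoc (leaves t) _ _))))

  coarsen-↭ : ∀ t → concatMap leaves (coarsen t) ↭ leaves t
  coarsen-↭ (leaf x)     = ↭-refl
  coarsen-↭ (node l _ r) = ↭-trans (merge-↭ (coarsen l) (coarsen r))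
                                   (++⁺ (coarsen-↭ l) (coarsen-↭ r))

  ∈-attach⁺ : ∀ {t x} us → x ∈ˡ leaves t → x ∈ˡ leaves (attach t us)
  ∈-attach⁺ us = ∈-resp-↭ (↭-sym (attach-↭ _ us)) ∘ ∈-++⁺ˡ

  ∈-attach⁻ : ∀ t us {x} → x ∈ˡ leaves (attach t us) →
              x ∈ˡ leaves t ⊎ ∃ λ u → u ∈ˡ us × x ∈ˡ leaves u
  ∈-attach⁻ t us = Sum.map₂ (find ∘ ∈-concatMap⁻ leaves) ∘
                   ∈-++⁻ (leaves t) ∘ ∈-resp-↭ (attach-↭ t us)

  connected-attach : ∀ {t us} → ConnectedTree t → All ConnectedTree us →
                     All (Touch t) us → ConnectedTree (attach t us)
  connected-attach ct []        []         = ct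
  connected-attach {us = _ ∷ us} ct (cu ∷ cus) ((x , y , x∈ , yxy) ∷ ts) =
    connected-node (connected-attach ct cus ts) cu (x , y , ∈-attach⁺ us x∈ , yxy)

  connected-absorb : ∀ {t F} → ConnectedTree t → All ConnectedTree F →
                     All ConnectedTree (absorb t F)
  connected-absorb {t} {F} ct cF =
    connected-attach ct (All.filter⁺ (touch? t) cF) (All.all-filter (touch? t) F)
    ∷ All.filter⁺ (∁? (touch? t)) cF

  connected-merge : ∀ {F F′} → All ConnectedTree F → All ConnectedTree F′ →
                    All ConnectedTree (merge F F′)
  connected-merge []       cF′ = cF′
  connected-merge (ct ∷ cF) cF′ = connected-absorb ct (connected-merge cF cF′)

  connected-coarsen : ∀ t → All ConnectedTree (coarsen t)
  connected-coarsen (leaf x)     = (connected-⁅⁆ {G = G} x ∷ []) ∷ []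
  connected-coarsen (node l _ r) =
    connected-merge (connected-coarsen l) (connected-coarsen r)

  apart-absorb : ∀ {t F} → AllPairs Apart F → AllPairs Apart (absorb t F)
  apart-absorb {t} {F} ap =
    All.tabulate apart ∷ AllPairs.filter⁺ (∁? (touch? t)) ap
    where
    apart : ∀ {v} → v ∈ˡ filter (∁? (touch? t)) F →
            Apart (attach t (filter (touch? t) F)) v
    apart v∈ (x , y , x∈ , yxy)
      with ∈-filter⁻ (∁? (touch? t)) {xs = F} v∈
         | ∈-attach⁻ t (filter (touch? t) F) x∈
    ... | v∈F , ¬tv | inj₁ x∈t = ¬tv (x , y , x∈t , yxy)
    ... | v∈F , ¬tv | inj₂ (u , u∈ , x∈u) with ∈-filter⁻ (touch? t) {xs = F} u∈
    ...   | u∈F , tu with same-or-apart ap u∈F v∈F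
    ...     | inj₁ refl = ¬tv tu
    ...     | inj₂ ¬uv  = ¬uv (x , y , x∈u , yxy)

  apart-merge : ∀ F {F′} → AllPairs Apart F′ → AllPairs Apart (merge F F′)
  apart-merge []      ap = ap
  apart-merge (t ∷ F) ap = apart-absorb (apart-merge F ap)

  apart-coarsen : ∀ t → AllPairs Apart (coarsen t)
  apart-coarsen (leaf x)     = [] ∷ []
  apart-coarsen (node l _ r) = apart-merge (coarsen l) (apart-coarsen r)

  module _ {x y : Fin n} {S : Subset n} where

    JoinedIn : List (BinTree n) → Set
    JoinedIn F = ∃ λ u → u ∈ˡ F × Joined x y u S

    attach-joined : ∀ {t} us → Joined x y t S → Joined x y (attach t us) S
    attach-joined []       j = j
    attach-joined (_ ∷ us) j = left (attach-joined us j)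

    attach-joinedIn : ∀ {t us u} → u ∈ˡ us → Joined x y u S →
                      Joined x y (attach t us) S
    attach-joinedIn (here refl) j = right j
    attach-joinedIn (there u∈)  j = left (attach-joinedIn u∈ j)

    absorb-joinedIn : ∀ {t F} → JoinedIn F → JoinedIn (absorb t F)
    absorb-joinedIn {t} (u , u∈ , j) with touch? t u
    ... | yes tu = _ , here refl , attach-joinedIn (∈-filter⁺ (touch? t) u∈ tu) j
    ... | no ¬tu = u , there (∈-filter⁺ (∁? (touch? t)) u∈ ¬tu) , j

    merge-joinedInʳ : ∀ F {F′} → JoinedIn F′ → JoinedIn (merge F F′)
    merge-joinedInʳ []      j = j
    merge-joinedInʳ (t ∷ F) j = absorb-joinedIn (merge-joinedInʳ F j)

    merge-joinedInˡ : ∀ F {F′} → JoinedIn F → JoinedIn (merge F F′)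
    merge-joinedInˡ (t ∷ F) (_ , here refl , j) =
      _ , here refl , attach-joined (filter (touch? t) (merge F _)) j
    merge-joinedInˡ (t ∷ F) (u , there u∈ , j)  =
      absorb-joinedIn (merge-joinedInˡ F (u , u∈ , j))

  adjacent⇒same-tree : ∀ {F u v x y} → AllPairs Apart F → u ∈ˡ F → v ∈ˡ F →
                       x ∈ˡ leaves u → y ∈ˡ leaves v → Adj x y → u ≡ v
  adjacent⇒same-tree ap u∈ v∈ x∈ y∈ xy with same-or-apart ap u∈ v∈
  ... | inj₁ u≡v = u≡v
  ... | inj₂ ¬uv = contradiction (_ , _ , x∈ , y∈ , xy) ¬uv

  ∈-coarsen : ∀ t {x} → x ∈ˡ leaves t → ∃ λ u → u ∈ˡ coarsen t × x ∈ˡ leaves u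
  ∈-coarsen t = find ∘ ∈-concatMap⁻ leaves ∘ ∈-resp-↭ (↭-sym (coarsen-↭ t))

  coarsen-⊆ : ∀ t {u} → u ∈ˡ coarsen t → cluster u ⊆ cluster t
  coarsen-⊆ t {u} u∈ = ∈-leaves⇒∈-cluster t ∘ ∈-resp-↭ (coarsen-↭ t) ∘
    (λ z∈ → ∈-concatMap⁺ leaves (lose u∈ z∈)) ∘ ∈-cluster⇒∈-leaves u

  adjacent⇒≢ : ∀ {x y} → Adj x y → x ≢ y
  adjacent⇒≢ xy refl = irrefl xy

  module _ {x y : Fin n} (xy : Adj x y) where

    coarsen-within : ∀ t → x ∈ˡ leaves t → y ∈ˡ leaves t →
                     ∃ λ S → S ⊆ cluster t × JoinedIn {x} {y} {S} (coarsen t)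
    coarsen-within t x∈ y∈ with ∈-coarsen t x∈ | ∈-coarsen t y∈
    ... | u , u∈ , x∈u | v , v∈ , y∈v
      with adjacent⇒same-tree (apart-coarsen t) u∈ v∈ x∈u y∈v xy
    ...   | refl with joined (adjacent⇒≢ xy) u x∈u y∈v
    ...     | S , j = S , coarsen-⊆ t u∈ ∘ joined⇒⊆ j , u , u∈ , j

    coarsen-joined : ∀ {t S} → Joined x y t S →
                     ∃ λ S′ → S′ ⊆ S × JoinedIn {x} {y} {S′} (coarsen t)
    coarsen-joined {t} j@(across _ _)  = uncurry (coarsen-within t) (joined⇒∈-leaves j)
    coarsen-joined {t} j@(across′ _ _) = uncurry (coarsen-within t) (joined⇒∈-leaves j)
    coarsen-joined (left {l} j)    =
      Product.map₂ (Product.map₂ (merge-joinedInˡ (coarsen l))) (coarsen-joined j)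
    coarsen-joined (right {l} j)   =
      Product.map₂ (Product.map₂ (merge-joinedInʳ (coarsen l))) (coarsen-joined j)

  connectify : Connected Adj → Fin n → (H : Hierarchy n) →
    ∃ λ H′ → ConnectedClusters G H′ ×
             (∀ {x y} → Adj x y → Hierarchy.C H′ x y ⊆ Hierarchy.C H x y)
  connectify conn x₀ H with ∈-coarsen (Hierarchy.tree H) (Hierarchy.complete H x₀)
  ... | u , u∈ , x₀∈ = H′ , All.lookup (connected-coarsen tree) u∈ , C′⊆C
    where
    open Hierarchy H

    spread : ∀ {k x y} → Walk Adj k x y → x ∈ˡ leaves u → y ∈ˡ leaves u
    spread []               x∈ = x∈
    spread (_∷_ {y = z} xz w) x∈ with ∈-coarsen tree (complete z)
    ... | v , v∈ , z∈ with adjacent⇒same-tree (apart-coarsen tree) u∈ v∈ x∈ z∈ xz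
    ...   | refl = spread w z∈

    H′ : Hierarchy n
    H′ = record
      { tree     = u
      ; unique   = unique-concatMap⁻
                     (Unique-resp-↭ (setoid _)
                       (↭⇒↭ₛ (↭-sym (coarsen-↭ tree))) unique) u∈
      ; complete = λ x → spread (proj₂ (conn x₀ x)) x₀∈
      }

    C′⊆C : ∀ {x y} → Adj x y → Hierarchy.C H′ x y ⊆ C x y
    C′⊆C {x} {y} xy with joined (adjacent⇒≢ xy) tree (complete x) (complete y)
    ... | S , j with coarsen-joined xy j
    ...   | S′ , S′⊆S , v , v∈ , j′
      with adjacent⇒same-tree (apart-coarsen tree) u∈ v∈
             (Hierarchy.complete H′ x) (proj₂ (joined⇒∈-leaves j′)) xy
    ...     | refl
      rewrite lcaCluster-joined (Hierarchy.unique H′) j′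
            | lcaCluster-joined unique j = S′⊆S

length-leaves>0 : (t : BinTree n) → 0 < length (leaves t)
length-leaves>0 t = ∈-length (proj₂ (some-leaf t))

treesUpTo : ℕ → List (BinTree n)
treesUpTo     zero    = []
treesUpTo {n} (suc d) = map leaf (allFin n) ++
  cartesianProductWith (λ l r → node l tt r) (treesUpTo d) (treesUpTo d)

∈-treesUpTo : ∀ d (t : BinTree n) → length (leaves t) ≤ d → t ∈ˡ treesUpTo d
∈-treesUpTo zero    t            p = contradiction (≤-trans (length-leaves>0 t) p) λ ()
∈-treesUpTo (suc d) (leaf x)     p = ∈-++⁺ˡ (∈-map⁺ leaf (∈-allFin x))
∈-treesUpTo (suc d) (node l _ r) p =
  ∈-++⁺ʳ (map leaf (allFin _)) (∈-cartesianProductWith⁺ (λ l r → node l tt r)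
    (∈-treesUpTo d l (s≤s⁻¹ (≤-trans (m<m+n _ (length-leaves>0 r)) sum≤)))
    (∈-treesUpTo d r (s≤s⁻¹ (≤-trans (m<n+m _ (length-leaves>0 l)) sum≤))))
  where
  sum≤ : length (leaves l) ℕ.+ length (leaves r) ≤ suc d
  sum≤ = ≤-trans (≤-reflexive (sym (length-++ (leaves l)))) p

IsHierarchy : BinTree n → Set
IsHierarchy t = Unique (leaves t) × (∀ x → x ∈ˡ leaves t)

isHierarchy? : (t : BinTree n) → Dec (IsHierarchy t)
isHierarchy? t = unique? (leaves t) ×-dec all? (λ x → x ∈ˡ? leaves t)

hierarchy : {t : BinTree n} → IsHierarchy t → Hierarchy n
hierarchy {t = t} (u , c) = record { tree = t ; unique = u ; complete = c }

isHierarchy : (H : Hierarchy n) → IsHierarchy (Hierarchy.tree H)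
isHierarchy H = Hierarchy.unique H , Hierarchy.complete H

caterpillar : Fin n → List (Fin n) → BinTree n
caterpillar x []       = leaf x
caterpillar x (y ∷ ys) = node (leaf x) tt (caterpillar y ys)

leaves-caterpillar : ∀ (x : Fin n) ys → leaves (caterpillar x ys) ≡ x ∷ ys
leaves-caterpillar x []       = refl
leaves-caterpillar x (y ∷ ys) = cong (x ∷_) (leaves-caterpillar y ys)

some-hierarchy : Fin n → ∃ (IsHierarchy {n})
some-hierarchy {suc n} _ =
  caterpillar Fin.zero (tabulate Fin.suc) ,
  subst (λ xs → Unique xs × (∀ x → x ∈ˡ xs))
        (sym (leaves-caterpillar Fin.zero (tabulate Fin.suc)))
        (Unique.allFin⁺ (suc n) , ∈-allFin)

module FieldProperties {c ℓ₁ ℓ₂} (K : OrderedField c ℓ₁ ℓ₂) where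
  open OrderedField K
    renaming (_≤_ to _≤ᴷ_; _+_ to _+ᴷ_; refl to ≈-refl; trans to ≈-trans; sym to ≈-sym)
  open IsTotalOrder isTotalOrder public using ()
    renaming (reflexive to ≤ᴷ-reflexive; trans to ≤ᴷ-trans; antisym to ≤ᴷ-antisym;
              total to ≤ᴷ-total)
  open import Algebra.Properties.Ring ring using (-1*x≈-x)
  open import Algebra.Properties.Group +-group using (⁻¹-involutive)

  totalOrder : TotalOrder c ℓ₁ ℓ₂
  totalOrder = record { isTotalOrder = isTotalOrder }

  +-mono-≤ᴷ : ∀ {x y u v} → x ≤ᴷ y → u ≤ᴷ v → (x +ᴷ u) ≤ᴷ (y +ᴷ v)
  +-mono-≤ᴷ {x} {y} {u} {v} p q = ≤ᴷ-trans (+-monoʳ-≤ x q)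
    (≤ᴷ-trans (≤ᴷ-reflexive (+-comm x v))
      (≤ᴷ-trans (+-monoʳ-≤ v p) (≤ᴷ-reflexive (+-comm v y))))

  0≤1 : 0# ≤ᴷ 1#
  0≤1 with ≤ᴷ-total 0# 1#
  ... | inj₁ p = p
  ... | inj₂ p = ≤ᴷ-trans (*-nonneg 0≤-1 0≤-1)
                   (≤ᴷ-reflexive (≈-trans (-1*x≈-x (- 1#)) (⁻¹-involutive 1#)))
    where
    0≤-1 : 0# ≤ᴷ - 1#
    0≤-1 = ≤ᴷ-trans (≤ᴷ-reflexive (≈-sym (-‿inverseˡ 1#)))
             (≤ᴷ-trans (+-monoʳ-≤ (- 1#) p) (≤ᴷ-reflexive (+-identityʳ (- 1#))))

  0≤fromℕ : ∀ k → 0# ≤ᴷ fromℕ k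
  0≤fromℕ zero    = ≤ᴷ-reflexive ≈-refl
  0≤fromℕ (suc k) = ≤ᴷ-trans (≤ᴷ-reflexive (≈-sym (+-identityʳ 0#)))
                             (+-mono-≤ᴷ 0≤1 (0≤fromℕ k))

  *-fromℕ-mono : ∀ {w} → 0# ≤ᴷ w → ∀ {j k} → j ≤ k → (w * fromℕ j) ≤ᴷ (w * fromℕ k)
  *-fromℕ-mono {w} 0≤w (z≤n {k}) =
    ≤ᴷ-trans (≤ᴷ-reflexive (zeroʳ w)) (*-nonneg 0≤w (0≤fromℕ k))
  *-fromℕ-mono {w} 0≤w (s≤s j≤k) = ≤ᴷ-trans (≤ᴷ-reflexive (distribˡ w _ _))
    (≤ᴷ-trans (+-monoʳ-≤ _ (*-fromℕ-mono 0≤w j≤k)) (≤ᴷ-reflexive (≈-sym (distribˡ w _ _))))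

  sum-mono : ∀ m {f g : Fin m → Carrier} → (∀ i → f i ≤ᴷ g i) → sum f ≤ᴷ sum g
  sum-mono zero    f≤g = ≤ᴷ-reflexive ≈-refl
  sum-mono (suc m) f≤g = +-mono-≤ᴷ (f≤g Fin.zero) (sum-mono m (f≤g ∘ Fin.suc))

module CostProperties {c ℓ₁ ℓ₂} (K : OrderedField c ℓ₁ ℓ₂) (G : Graph n)
  (w : Graph.Edge G → OrderedField.Carrier K) (w>0 : Optima.Positive K G w) where
  open OrderedField K using (Carrier) renaming (_≤_ to _≤ᴷ_; refl to ≈-refl)
  open FieldProperties K
  open Graph G hiding (sym)
  open Optima K G
  open Hierarchy

  edgeSum-mono : ∀ {f g} → (∀ {x y} → Adj x y → f x y ≤ g x y) →
                 edgeSum w f ≤ᴷ edgeSum w g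
  edgeSum-mono {f} {g} f≤g = sum-mono n λ x → sum-mono n λ y → term x y
    where
    term : ∀ x y → edgeTerm w f x y ≤ᴷ edgeTerm w g x y
    term x y with (x Fin.<? y) ×-dec T? (adj x y)
    ... | yes (x<y , xy) = *-fromℕ-mono (proj₁ (w>0 (edge x<y xy))) (f≤g xy)
    ... | no  _          = ≤ᴷ-reflexive ≈-refl

  h≡∣C∣∸1 : ∀ (H : Hierarchy n) {x y} → x ≢ y → h H x y ≡ ∣ C H x y ∣ ∸ 1
  h≡∣C∣∸1 H {x} {y} x≢y rewrite dec-false (x Fin.≟ y) x≢y = refl

  shifted≤cost : ∀ H → shiftedDasguptaCost w H ≤ᴷ cost w H
  shifted≤cost H = edgeSum-mono λ xy →
    ≤-reflexive (sym (h≡∣C∣∸1 H λ { refl → irrefl xy }))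

  cost≤shifted : ∀ H → cost w H ≤ᴷ shiftedDasguptaCost w H
  cost≤shifted H = edgeSum-mono λ xy →
    ≤-reflexive (h≡∣C∣∸1 H λ { refl → irrefl xy })

  shifted-minimum : Fin n →
    ∃ λ H → ∀ H′ → shiftedDasguptaCost w H ≤ᴷ shiftedDasguptaCost w H′
  shifted-minimum x₀ with some-hierarchy x₀
  ... | t₀ , valid₀ =
    hierarchy {t = best}
      (argmin-all treeCost valid₀ (All.all-filter isHierarchy? (treesUpTo n))) ,
    λ H → All.lookup (f[argmin]≤f[xs] t₀ candidates)
      (∈-filter⁺ isHierarchy? (∈-treesUpTo n (tree H) (length≤n H)) (isHierarchy H))
    where
    open Extrema totalOrder using (argmin; argmin-all; f[argmin]≤f[xs])

    treeCost : BinTree n → Carrier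
    treeCost t = edgeSum w λ x y → ∣ lcaCluster t x y ∣ ∸ 1

    candidates : List (BinTree n)
    candidates = filter isHierarchy? (treesUpTo n)

    best : BinTree n
    best = argmin treeCost t₀ candidates

    length≤n : ∀ H → length (leaves (tree H)) ≤ n
    length≤n H = ≤-trans
      (unique⇒length≤∣p∣ {p = ⊤} (unique H) (All.tabulate λ _ → ∈⊤)) (∣p∣≤n ⊤)

  shifted-mono : ∀ {H H′} → (∀ {x y} → Adj x y → C H′ x y ⊆ C H x y) →
                 shiftedDasguptaCost w H′ ≤ᴷ shiftedDasguptaCost w H
  shifted-mono C′⊆C = edgeSum-mono λ xy → ∸-monoˡ-≤ 1 (p⊆q⇒∣p∣≤∣q∣ (C′⊆C xy))

module _ (H : Hierarchy n) where
  open Hierarchy H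

  C-self : ∀ x → C x x ≡ ⁅ x ⁆
  C-self x = lcaCluster-self tree unique (complete x)

  ∣C-self∣ : ∀ x → ∣ C x x ∣ ∸ 1 ≡ 0
  ∣C-self∣ x rewrite C-self x = cong (_∸ 1) (∣⁅x⁆∣≡1 x)

  h-self : ∀ x → h x x ≡ 0
  h-self x rewrite dec-true (x Fin.≟ x) refl = refl

module _ {G : Graph n} (conn : Connected (Graph.Adj G)) (H : Hierarchy n)
  (cH : ConnectedClusters G H) where
  open Metric G conn
  open Hierarchy H

  C-connected : ∀ {x y} → x ≢ y → (x ∈ C x y × y ∈ C x y) ×
                Connected (Graph.Induced G (C x y))
  C-connected {x} {y} x≢y with joined x≢y tree (complete x) (complete y)
  ... | S , j rewrite lcaCluster-joined unique j =
    joined⇒∈ j , All.lookup cH (joined⇒∈-clusters j)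

  dist≤diam-C : ∀ {x y} → x ≢ y → dist x y ≤ diam (C x y)
  dist≤diam-C x≢y = uncurry (dist≤diam G conn) (proj₁ (C-connected x≢y))

  diam-C≤ : ∀ {x y} → x ≢ y → diam (C x y) ≤ ∣ C x y ∣ ∸ 1
  diam-C≤ x≢y = diam≤∣S∣∸1 G conn _ (proj₂ (C-connected x≢y))

  dist≤h : ∀ x y → dist x y ≤ h x y
  dist≤h x y with x Fin.≟ y
  ... | yes refl = ≤-reflexive (dist-refl G conn x)
  ... | no  x≢y  = ≤-trans (dist≤diam-C x≢y) (diam-C≤ x≢y)

corollary4 :
    ∀ {c ℓ₁ ℓ₂} (K : OrderedField c ℓ₁ ℓ₂) (n : ℕ) → 2 ≤ n →
    (G : Graph n) (conn : Connected (Graph.Adj G)) →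
    (w : Graph.Edge G → OrderedField.Carrier K) → Optima.Positive K G w →
    let open Metric G conn
        open Optima K G
        open Hierarchy
    in
    (∃ λ m → IsOPTᴰ⁻ w m × IsOPTcard conn w m × IsOPTconn w m)
    ×
    (∀ (T : Hierarchy n) → ConnectedClusters G T →
      (∀ x y → x ≢ y →
        dist x y ≤ diam (C T x y) ×
        diam (C T x y) ≤ ∣ C T x y ∣ ∸ 1 ×
        ∣ C T x y ∣ ∸ 1 ≡ h T x y) ×
      (∀ x →
        dist x x ≡ 0 × diam (C T x x) ≡ 0 ×
        ∣ C T x x ∣ ∸ 1 ≡ 0 × h T x x ≡ 0) ×
      (∀ x y → dist x y ≤ h T x y))
corollary4 K n@(suc _) 2≤n G conn w w>0 =
  let open CostProperties K G w w>0
      open FieldProperties K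
      open Optima K G
      (H , H-min)       = shifted-minimum Fin.zero
      (H′ , cH′ , C′⊆C) = Coarsening.connectify G conn Fin.zero H
      m≤cost            = λ J → ≤ᴷ-trans (H-min J) (shifted≤cost J)
      cost≈m            =
        ≤ᴷ-antisym (≤ᴷ-trans (cost≤shifted H′) (shifted-mono {H} {H′} C′⊆C)) (m≤cost H′)
  in
  ( shiftedDasguptaCost w H
  , ((H , tt , OrderedField.refl K) , λ J _ → H-min J)
  , ((H′ , dist≤h conn H′ cH′ , cost≈m) , λ J _ → m≤cost J)
  , ((H′ , cH′ , cost≈m) , λ J _ → m≤cost J)) ,
  λ T cT →
    (λ x y x≢y → dist≤diam-C conn T cT x≢y , diam-C≤ conn T cT x≢y ,
                 sym (h≡∣C∣∸1 T x≢y)) ,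
    (λ x → dist-refl G conn x ,
           trans (cong (Metric.diam G conn) (C-self T x)) (diam-⁅⁆ G conn x) ,
           ∣C-self∣ T x , h-self T x) ,
    dist≤h conn T cT
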